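{- Let $G=\{1,\rho\}\le S_n$ be a 2-element subgroup whose non-identity element $\rho$ is a product of pairwise disjoint transpositions. Then $B_n/G$ is a symmetric chain order.
   Context: A finite poset $P$ is ranked if it has a minimum element and all saturated chains from the minimum to any $x$ have the same length $r(x)$; $r(P)=\max_x r(x)$. A chain $x_1<\dots<x_k$ is symmetric if it is saturated and $r(x_1)+r(x_k)=r(P)$; a symmetric chain order (SCO) is a ranked poset that can be partitioned into symmetric chains. $B_n$ is the Boolean lattice of subsets of $[n]$; $S_n$ acts by $\sigma(A)=\sigma[A]$, and for $G\le S_n$, $B_n/G$ is the poset of $G$-orbits $[A]$ with $[A]\le[B]$ iff $X\subseteq Y$ for some $X\in[A]$, $Y\in[B]$. -}

module Defs where

open import Data.Bool.Base using (true; false; if_then_else_)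
open import Data.Fin.Base using (Fin)
open import Data.Fin.Permutation as Perm
  using (Permutation′; _⟨$⟩ʳ_; _⟨$⟩ˡ_; _∘ₚ_; flip; inverseˡ; inverseʳ)
open import Data.Fin.Permutation.Transposition.List using (TranspositionList; eval)
open import Data.Fin.Subset using (Subset; _∈_; _⊆_; ∣_∣)
open import Data.Fin.Subset.Properties
  using (_∈?_; ⊆-antisym; ⊆-refl; p⊆q⇒∣p∣≤∣q∣; p⊂q⇒∣p∣<∣q∣)
open import Data.List.Base using (List; length; lookup)
open import Data.List.NonEmpty.Base using (List⁺; toList; head; tail; last)
import Data.List.Membership.Setoid as ListMembership
import Data.List.Relation.Unary.Enumerates.Setoid as Enumeration
open import Data.List.Relation.Unary.All using (All)
open import Data.List.Relation.Unary.AllPairs using (AllPairs)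
open import Data.List.Relation.Unary.Linked using (Linked)
open import Data.Nat.Base using (ℕ; _+_; _≤_)
import Data.Nat.Properties as ℕ
open import Data.Product using (Σ; ∃; ∃-syntax; ∃!; _×_; _,_)
open import Data.Vec.Base as Vec using ([]; _∷_; tabulate)
open import Data.Vec.Properties
  using (lookup∘tabulate; tabulate∘lookup; tabulate-cong; lookup⇒[]=; []=⇒lookup)
open import Data.Vec.Functional using (Vector)
open import Function.Base using (_∘_)
open import Function.Bundles using (_⇔_; mk⇔)
open import Level using (Level; 0ℓ; _⊔_)
open import Relation.Binary.Bundles using (Poset)
open import Relation.Binary.Core using (Rel)
open import Relation.Binary.Definitions using (Minimum)
import Relation.Binary.Properties.Poset as PosetProperties
open import Relation.Binary.PropositionalEquality.Core
  using (_≡_; _≢_; refl; sym; trans; cong; subst)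
open import Relation.Nullary.Decidable.Core using (yes; no)
open import Relation.Nullary.Negation.Core using (¬_; contradiction)
open import Relation.Unary using (Pred)

module _ {c ℓ₁ ℓ₂ : Level} (P : Poset c ℓ₁ ℓ₂) where
  private module P = Poset P
  open P using (Carrier; _≈_)
  open PosetProperties P using (_<_)
  open ListMembership P.Eq.setoid using () renaming (_∈_ to _∈ₗ_)
  open Enumeration P.Eq.setoid using (IsEnumeration)

  infix 4 _⋖_

  _⋖_ : Rel Carrier (c ⊔ ℓ₁ ⊔ ℓ₂)
  x ⋖ y = x < y × (∀ z → ¬ (x < z × z < y))

  IsSaturated : Pred (List⁺ Carrier) (c ⊔ ℓ₁ ⊔ ℓ₂)
  IsSaturated xs = Linked _⋖_ (toList xs)

  IsSaturatedFromTo : Carrier → Carrier → Pred (List⁺ Carrier) (c ⊔ ℓ₁ ⊔ ℓ₂)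
  IsSaturatedFromTo x y xs = IsSaturated xs × head xs ≈ x × last xs ≈ y

  -- The length of x₁ < … < xₖ is k - 1, so that the minimum has rank 0.
  chainLength : List⁺ Carrier → ℕ
  chainLength = length ∘ tail

  record Ranked : Set (c ⊔ ℓ₁ ⊔ ℓ₂) where
    field
      finite  : ∃ IsEnumeration
      bottom  : Carrier
      minimum : Minimum P._≤_ bottom
      rank    : Carrier → ℕ
      -- In a finite poset a saturated chain from the minimum to x always
      -- exists classically; requiring one determines the rank function.
      rank-attained : ∀ x → ∃[ xs ] (IsSaturatedFromTo bottom x xs × chainLength xs ≡ rank x)
      rank-unique   : ∀ x xs → IsSaturatedFromTo bottom x xs → chainLength xs ≡ rank x
      -- height = max rank
      height          : ℕ
      rank≤height     : ∀ x → rank x ≤ height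
      height-attained : ∃[ x ] rank x ≡ height

  IsSymmetric : Ranked → Pred (List⁺ Carrier) (c ⊔ ℓ₁ ⊔ ℓ₂)
  IsSymmetric R xs = IsSaturated xs × rank (head xs) + rank (last xs) ≡ height
    where open Ranked R

  IsPartition : Pred (List (List⁺ Carrier)) (c ⊔ ℓ₁)
  IsPartition xss = ∀ x → ∃! _≡_ λ (i : Fin (length xss)) → x ∈ₗ toList (lookup xss i)

  IsSymmetricChainOrder : Set (c ⊔ ℓ₁ ⊔ ℓ₂)
  IsSymmetricChainOrder =
    Σ Ranked λ R → ∃[ xss ] (All (IsSymmetric R) xss × IsPartition xss)

record Subgroup (n : ℕ) : Set₁ where
  field
    Member      : Pred (Permutation′ n) 0ℓ
    resp-≈      : ∀ {σ τ} → σ Perm.≈ τ → Member σ → Member τ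
    id-closed   : Member Perm.id
    ∘-closed    : ∀ {σ τ} → Member σ → Member τ → Member (σ ∘ₚ τ)
    flip-closed : ∀ {σ} → Member σ → Member (flip σ)

IsTransposition : ∀ {n} → Pred (Fin n × Fin n) 0ℓ
IsTransposition (i , j) = i ≢ j

Disjoint : ∀ {n} → Rel (Fin n × Fin n) 0ℓ
Disjoint (i , j) (k , l) = i ≢ k × i ≢ l × j ≢ k × j ≢ l

IsProductOfDisjointTranspositions : ∀ {n} → Pred (Permutation′ n) 0ℓ
IsProductOfDisjointTranspositions {n} ρ =
  Σ (TranspositionList n) λ ts →
    All IsTransposition ts × AllPairs Disjoint ts × ρ Perm.≈ eval ts

infixr 8 _[_]

-- i ∈ σ [ A ] iff σ⁻¹ i ∈ A; see ∈-image for the usual description.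
_[_] : ∀ {n} → Permutation′ n → Subset n → Subset n
σ [ A ] = tabulate λ i → Vec.lookup A (σ ⟨$⟩ˡ i)

private
  variable
    n : ℕ

  ∈-image⁻ : ∀ (σ : Permutation′ n) A {i} → i ∈ σ [ A ] → σ ⟨$⟩ˡ i ∈ A
  ∈-image⁻ σ A {i} i∈ =
    lookup⇒[]= _ A (trans (sym (lookup∘tabulate _ i)) ([]=⇒lookup i∈))

  ∈-image⁺ : ∀ (σ : Permutation′ n) A {i} → σ ⟨$⟩ˡ i ∈ A → i ∈ σ [ A ]
  ∈-image⁺ σ A {i} i∈ =
    lookup⇒[]= i _ (trans (lookup∘tabulate _ i) ([]=⇒lookup i∈))

∈-image : ∀ (σ : Permutation′ n) A i → i ∈ σ [ A ] ⇔ (∃[ j ] (j ∈ A × σ ⟨$⟩ʳ j ≡ i))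
∈-image σ A i = mk⇔
  (λ i∈ → _ , ∈-image⁻ σ A i∈ , inverseʳ σ)
  (λ { (j , j∈ , refl) → ∈-image⁺ σ A (subst (_∈ A) (sym (inverseˡ σ)) j∈) })

image-mono : ∀ (σ : Permutation′ n) {A B} → A ⊆ B → σ [ A ] ⊆ σ [ B ]
image-mono σ {A} {B} A⊆B = ∈-image⁺ σ B ∘ A⊆B ∘ ∈-image⁻ σ A

image-id : ∀ (A : Subset n) → Perm.id [ A ] ≡ A
image-id = tabulate∘lookup

-- σ ∘ₚ τ applies σ first.
image-∘ : ∀ (σ τ : Permutation′ n) A → (σ ∘ₚ τ) [ A ] ≡ τ [ σ [ A ] ]
image-∘ σ τ A = tabulate-cong λ i → sym (lookup∘tabulate _ (τ ⟨$⟩ˡ i))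

image-flip : ∀ (σ : Permutation′ n) A → flip σ [ σ [ A ] ] ≡ A
image-flip σ A = trans
  (tabulate-cong λ i → trans (lookup∘tabulate _ (σ ⟨$⟩ʳ i)) (cong (Vec.lookup A) (inverseˡ σ)))
  (tabulate∘lookup A)

private
  open import Algebra.Properties.CommutativeMonoid.Sum ℕ.+-0-commutativeMonoid
    using (sum; sum-cong-≗; sum-permute)

  indicator : Subset n → Vector ℕ n
  indicator A i = if Vec.lookup A i then 1 else 0

  ∣∣≡sum : ∀ (A : Subset n) → ∣ A ∣ ≡ sum (indicator A)
  ∣∣≡sum []          = refl
  ∣∣≡sum (true  ∷ A) = cong (1 +_) (∣∣≡sum A)
  ∣∣≡sum (false ∷ A) = ∣∣≡sum A

∣image∣ : ∀ (σ : Permutation′ n) A → ∣ σ [ A ] ∣ ≡ ∣ A ∣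
∣image∣ σ A =
  trans (∣∣≡sum (σ [ A ]))
  (trans (sum-cong-≗ {x = indicator (σ [ A ])} {y = λ i → indicator A (σ ⟨$⟩ˡ i)}
            λ i → cong (if_then 1 else 0) (lookup∘tabulate _ i))
  (trans (sym (sum-permute (indicator A) (flip σ)))
         (sym (∣∣≡sum A))))

private
  ⊆∧∣∣≥⇒≡ : ∀ {A B : Subset n} → A ⊆ B → ∣ B ∣ ≤ ∣ A ∣ → A ≡ B
  ⊆∧∣∣≥⇒≡ {A = A} {B} A⊆B ∣B∣≤∣A∣ = ⊆-antisym A⊆B B⊆A
    where
    B⊆A : B ⊆ A
    B⊆A {x} x∈B with x ∈? A
    ... | yes x∈A = x∈A
    ... | no  x∉A = contradiction ∣B∣≤∣A∣ (ℕ.<⇒≱ (p⊂q⇒∣p∣<∣q∣ (A⊆B , x , x∈B , x∉A)))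

module _ {n : ℕ} (G : Subgroup n) where
  open Subgroup G

  infix 4 _∈Orbit_ _≤ᴳ_

  record _∈Orbit_ (X A : Subset n) : Set where
    constructor mkOrbit
    field
      perm    : Permutation′ n
      member  : Member perm
      image-≡ : perm [ A ] ≡ X

  record _≤ᴳ_ (A B : Subset n) : Set where
    constructor mk≤
    field
      {X Y} : Subset n
      X∈[A] : X ∈Orbit A
      Y∈[B] : Y ∈Orbit B
      X⊆Y   : X ⊆ Y

  private
    orbit-refl : ∀ {A} → A ∈Orbit A
    orbit-refl = mkOrbit _ id-closed (image-id _)

    orbit-sym : ∀ {A B} → A ∈Orbit B → B ∈Orbit A
    orbit-sym (mkOrbit σ σ∈ refl) = mkOrbit (flip σ) (flip-closed σ∈) (image-flip σ _)

    orbit-trans : ∀ {A B C} → A ∈Orbit B → B ∈Orbit C → A ∈Orbit C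
    orbit-trans {C = C} (mkOrbit τ τ∈ refl) (mkOrbit σ σ∈ refl) =
      mkOrbit (σ ∘ₚ τ) (∘-closed σ∈ τ∈) (image-∘ σ τ C)

    ∣orbit∣ : ∀ {A X} → X ∈Orbit A → ∣ X ∣ ≡ ∣ A ∣
    ∣orbit∣ {A} (mkOrbit σ _ refl) = ∣image∣ σ A

    ≤ᴳ⇒∣∣≤ : ∀ {A B} → A ≤ᴳ B → ∣ A ∣ ≤ ∣ B ∣
    ≤ᴳ⇒∣∣≤ (mk≤ {X} {Y} X∈ Y∈ X⊆Y) = begin
      _     ≡⟨ ∣orbit∣ X∈ ⟨
      ∣ X ∣ ≤⟨ p⊆q⇒∣p∣≤∣q∣ X⊆Y ⟩
      ∣ Y ∣ ≡⟨ ∣orbit∣ Y∈ ⟩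
      _     ∎
      where open ℕ.≤-Reasoning

    ≤ᴳ-reflexive : ∀ {A B} → A ∈Orbit B → A ≤ᴳ B
    ≤ᴳ-reflexive A∈ = mk≤ orbit-refl A∈ ⊆-refl

    ≤ᴳ-trans : ∀ {A B C} → A ≤ᴳ B → B ≤ᴳ C → A ≤ᴳ C
    ≤ᴳ-trans (mk≤ X∈A Y∈B X⊆Y) (mk≤ X′∈B Y′∈C X′⊆Y′)
      with orbit-trans Y∈B (orbit-sym X′∈B)
    ... | mkOrbit σ σ∈ σX′≡Y =
      mk≤ X∈A (orbit-trans (mkOrbit σ σ∈ refl) Y′∈C)
          (image-mono σ X′⊆Y′ ∘ subst (_ ∈_) (sym σX′≡Y) ∘ X⊆Y)

    ≤ᴳ-antisym : ∀ {A B} → A ≤ᴳ B → B ≤ᴳ A → A ∈Orbit B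
    ≤ᴳ-antisym {A} {B} (mk≤ {X} {Y} X∈A Y∈B X⊆Y) B≤A
      with ⊆∧∣∣≥⇒≡ X⊆Y ∣Y∣≤∣X∣
      where
      open ℕ.≤-Reasoning
      ∣Y∣≤∣X∣ : ∣ Y ∣ ≤ ∣ X ∣
      ∣Y∣≤∣X∣ = begin
        ∣ Y ∣ ≡⟨ ∣orbit∣ Y∈B ⟩
        ∣ B ∣ ≤⟨ ≤ᴳ⇒∣∣≤ B≤A ⟩
        ∣ A ∣ ≡⟨ ∣orbit∣ X∈A ⟨
        ∣ X ∣ ∎
    ... | refl = orbit-trans (orbit-sym X∈A) Y∈B

  -- An orbit is represented by any of its elements: A stands for [A], and
  -- [A] = [B] is rendered as A ∈Orbit B.
  BooleanQuotient : Poset 0ℓ 0ℓ 0ℓ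
  BooleanQuotient = record
    { Carrier = Subset n
    ; _≈_     = _∈Orbit_
    ; _≤_     = _≤ᴳ_
    ; isPartialOrder = record
      { isPreorder = record
        { isEquivalence = record
          { refl = orbit-refl ; sym = orbit-sym ; trans = orbit-trans }
        ; reflexive = ≤ᴳ-reflexive
        ; trans     = ≤ᴳ-trans
        }
      ; antisym = ≤ᴳ-antisym
      }
    }

{-# OPTIONS --safe #-}

-- ρ is an involution. With I = { i ∣ i < ρ i } and F the set of fixed points
-- of ρ, the map (U , V , W) ↦ U ∪ ρ[V] ∪ W identifies the product of the
-- Boolean lattices on I, I and F with B_n, and ρ acts as the swap of U and V.
-- So the quotient is the symmetric square of B_∣I∣ times B_∣F∣. If B_∣I∣ is
-- partitioned into symmetric chains C₁, …, Cₖ, its symmetric square is the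
-- union of the grids Cᵢ × Cⱼ (i < j) and of the triangles { x ≤ y } in Cᵢ × Cᵢ.
-- Both kinds of pieces are peeled into symmetric hooks, and so is a product of
-- a symmetric chain with a chain of B_∣F∣.
module Submission where

open import Defs
open import Data.Nat.Base using (ℕ)
open import Data.Sum.Base using (_⊎_)
open import Data.Fin.Permutation using (Permutation′; id; _≈_)
open import Function.Bundles using (_⇔_)
open import Relation.Nullary.Negation.Core using (¬_)

open import Algebra.Bundles using (CommutativeMonoid)
open import Algebra.Properties.CommutativeSemigroup using (interchange)
open import Data.Bool.Base as Bool using (Bool; true; false; f<t)
open import Data.Fin.Base as Fin using (Fin; zero; suc)
open import Data.Fin.Permutation using (_⟨$⟩ʳ_; _⟨$⟩ˡ_; _∘ₚ_; inverseˡ; inverseʳ)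
import Data.Fin.Properties as Fin
open import Data.Fin.Subset using (Subset; _∈_; _∉_; _⊆_; ∣_∣; ⊥; ⊤; _∪_)
open import Data.Fin.Subset.Properties
  using ( ⊆-refl; ⊆-antisym; ⊥⊆; ⊆⊤; out⊆; s⊆s; drop-∷-⊆; drop-there; x∈p∪q⁺; x∈p∪q⁻
        ; p⊆q⇒∣p∣≤∣q∣; ∣p∣≤n; ∣⊥∣≡0; ∣⊤∣≡n )
open import Data.List.Base as List
  using (List; []; _∷_; _++_; map; concatMap; applyUpTo; cartesianProduct; length; lookup)
import Data.List.Membership.Propositional as Propositional
import Data.List.Membership.Propositional.Properties as Propositional
import Data.List.Membership.Setoid as Membership
open import Data.List.NonEmpty.Base using (List⁺; _∷_; toList; last)
open import Data.List.Properties
  using ( map-++; concatMap-++; applyUpTo-∷ʳ; length-applyUpTo; map-applyUpTo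
        ; cartesianProductWith-distribʳ-++; cartesianProductWith-zeroʳ )
open import Data.List.Relation.Binary.Permutation.Propositional
  using ( _↭_; ↭-refl; ↭-reflexive; ↭-sym; ↭-trans; ↭⇒↭ₛ; ↭⇒↭ₛ′
        ; module PermutationReasoning )
import Data.List.Relation.Binary.Permutation.Propositional.Properties as ↭
import Data.List.Relation.Binary.Permutation.Setoid.Properties as ↭ₛ
open import Data.List.Relation.Unary.All as All using (All; []; _∷_)
import Data.List.Relation.Unary.All.Properties as All
open import Data.List.Relation.Unary.AllPairs as AllPairs using ([]; _∷_)
import Data.List.Relation.Unary.AllPairs.Properties as AllPairs
open import Data.List.Relation.Unary.Any as Any using (Any; here; there)
import Data.List.Relation.Unary.Any.Properties as Any
open import Data.List.Relation.Unary.Linked using (_∷_)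
import Data.List.Relation.Unary.Linked.Properties as Linked
import Data.List.Relation.Unary.Unique.Propositional as Propositional
import Data.List.Relation.Unary.Unique.Propositional.Properties as Propositional
import Data.List.Relation.Unary.Unique.Setoid as Unique
import Data.List.Relation.Unary.Unique.Setoid.Properties as Unique
open import Data.Nat.Base using (zero; suc; _+_; _≤_; _<_; z<s; s<s; s<s⁻¹)
import Data.Nat.Properties as ℕ
open import Data.Product using (∃; ∃-syntax; ∃!; _×_; _,_; proj₁; proj₂; swap)
open import Data.Product.Relation.Binary.Pointwise.NonDependent using (_×ₛ_)
open import Data.Sum.Base as Sum using (inj₁; inj₂; [_,_]′)
open import Data.Vec.Base as Vec using ([]; _∷_; tabulate; here; there)
open import Data.Vec.Properties
  using (tabulate-cong; lookup∘tabulate; lookup⇒[]=; []=⇒lookup; ∷-injective)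
open import Function.Base using (_∘_; case_of_)
open import Function.Bundles using (Equivalence)
open import Level using (0ℓ)
open import Relation.Binary.Bundles using (Poset; Setoid)
open import Relation.Binary.Core using (Rel)
open import Relation.Binary.Definitions using (tri<; tri≈; tri>)
import Relation.Binary.Properties.Poset as PosetProperties
open import Relation.Binary.PropositionalEquality
  using (_≡_; refl; sym; trans; cong; cong₂; subst; setoid; module ≡-Reasoning)
open import Relation.Nullary.Decidable using (yes; no; does; dec-true)
open import Relation.Nullary.Negation.Core using (contradiction)
open import Relation.Unary using (Pred; Decidable)

-- Symmetric chains involve only covers and ranks, so the order of the quotient is not compared with
-- that of the symmetric square. It is enough to find a transversal of the orbits inside `B_n` that
-- splits into symmetric chains of `B_n` itself: cardinality is constant on orbits, so a cover of
-- `B_n` stays a cover between orbits, and rank sums are unchanged. The difficulty is to orient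
-- every unordered pair so that the chosen ordered pairs are linked by covers. Orienting them along
-- a list in which each chain is contiguous does this, and it is why grids and triangles appear. A
-- triangle is not a product, but the hook along its left and upper edges meets the diagonal only at
-- its two ends and therefore stays inside.

private
  variable
    A B : Set
    h h′ n : ℕ

-- Lists of ordered and unordered pairs

++-interchange : ∀ (ws xs ys zs : List A) → (ws ++ xs) ++ (ys ++ zs) ↭ (ws ++ ys) ++ (xs ++ zs)
++-interchange = interchange (CommutativeMonoid.commutativeSemigroup ↭.++-commutativeMonoid)

-- Only a permutation: the product is listed row by row, so splitting the second factor interleaves
-- the two blocks.
cartesianProduct-++ʳ : ∀ (xs : List A) (ys zs : List B) →
  cartesianProduct xs (ys ++ zs) ↭ cartesianProduct xs ys ++ cartesianProduct xs zs
cartesianProduct-++ʳ []       ys zs = ↭-refl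
cartesianProduct-++ʳ (x ∷ xs) ys zs = begin
  map (x ,_) (ys ++ zs) ++ cartesianProduct xs (ys ++ zs)
    ≡⟨ cong (_++ cartesianProduct xs (ys ++ zs)) (map-++ (x ,_) ys zs) ⟩
  (map (x ,_) ys ++ map (x ,_) zs) ++ cartesianProduct xs (ys ++ zs)
    ↭⟨ ↭.++⁺ˡ (map (x ,_) ys ++ map (x ,_) zs) (cartesianProduct-++ʳ xs ys zs) ⟩
  (map (x ,_) ys ++ map (x ,_) zs) ++ (cartesianProduct xs ys ++ cartesianProduct xs zs)
    ↭⟨ ++-interchange (map (x ,_) ys) (map (x ,_) zs) (cartesianProduct xs ys) (cartesianProduct xs zs) ⟩
  cartesianProduct (x ∷ xs) ys ++ cartesianProduct (x ∷ xs) zs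
    ∎
  where open PermutationReasoning

cartesianProduct-[-]ʳ : ∀ (xs : List A) (y : B) → cartesianProduct xs List.[ y ] ≡ map (_, y) xs
cartesianProduct-[-]ʳ []       y = refl
cartesianProduct-[-]ʳ (x ∷ xs) y = cong ((x , y) ∷_) (cartesianProduct-[-]ʳ xs y)

cartesianProduct⁺ : ∀ {xs xs′ : List A} {ys ys′ : List B} → xs ↭ xs′ → ys ↭ ys′ →
  cartesianProduct xs ys ↭ cartesianProduct xs′ ys′
cartesianProduct⁺ {xs = xs} {ys′ = ys′} xs↭ ys↭ = ↭-trans (right xs) (left xs↭)
  where
  right : ∀ xs → cartesianProduct xs _ ↭ cartesianProduct xs _
  right []       = ↭-refl
  right (x ∷ xs) = ↭.++⁺ (↭.map⁺ (x ,_) ys↭) (right xs)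

  left : ∀ {xs xs′} → xs ↭ xs′ → cartesianProduct xs ys′ ↭ cartesianProduct xs′ ys′
  left _↭_.refl           = ↭-refl
  left (_↭_.prep x p)     = ↭.++⁺ˡ (map (x ,_) ys′) (left p)
  left (_↭_.swap x y p)   = ↭-trans
    (↭.shifts (map (x ,_) ys′) (map (y ,_) ys′))
    (↭.++⁺ˡ (map (y ,_) ys′) (↭.++⁺ˡ (map (x ,_) ys′) (left p)))
  left (_↭_.trans p q)    = ↭-trans (left p) (left q)

-- Each pair is oriented by list order. The diagonal is kept, since pairs `(U , U)` are the fixed
-- points of the swap.
unorderedPairs : List A → List (A × A)
unorderedPairs []       = []
unorderedPairs (x ∷ xs) = map (x ,_) (x ∷ xs) ++ unorderedPairs xs

-- The source of the pieces: for a chain followed by the other chains, the pairs inside the chain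
-- form a triangle and the mixed pairs form grids.
unorderedPairs-++ : ∀ (xs ys : List A) →
  unorderedPairs (xs ++ ys) ↭ unorderedPairs xs ++ (cartesianProduct xs ys ++ unorderedPairs ys)
unorderedPairs-++ []       ys = ↭-refl
unorderedPairs-++ (x ∷ xs) ys = begin
  map (x ,_) (x ∷ xs ++ ys) ++ unorderedPairs (xs ++ ys)
    ≡⟨ cong (_++ unorderedPairs (xs ++ ys)) (map-++ (x ,_) (x ∷ xs) ys) ⟩
  (map (x ,_) (x ∷ xs) ++ map (x ,_) ys) ++ unorderedPairs (xs ++ ys)
    ↭⟨ ↭.++⁺ˡ (map (x ,_) (x ∷ xs) ++ map (x ,_) ys) (unorderedPairs-++ xs ys) ⟩
  (map (x ,_) (x ∷ xs) ++ map (x ,_) ys) ++ (unorderedPairs xs ++ (cartesianProduct xs ys ++ unorderedPairs ys))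
    ↭⟨ ++-interchange (map (x ,_) (x ∷ xs)) (map (x ,_) ys) (unorderedPairs xs) _ ⟩
  unorderedPairs (x ∷ xs) ++ (map (x ,_) ys ++ (cartesianProduct xs ys ++ unorderedPairs ys))
    ↭⟨ ↭.++⁺ˡ (unorderedPairs (x ∷ xs)) (↭-sym (↭.++-assoc (map (x ,_) ys) _ _)) ⟩
  unorderedPairs (x ∷ xs) ++ (cartesianProduct (x ∷ xs) ys ++ unorderedPairs ys)
    ∎
  where open PermutationReasoning

-- Graded sets, symmetric chains and decompositions

record Graded : Set₁ where
  infix 4 _⟶_
  field
    Carrier : Set
    _⟶_     : Rel Carrier 0ℓ
    rank    : Carrier → ℕ
    rank-⟶  : ∀ {x y} → x ⟶ y → rank y ≡ suc (rank x)

open Graded using (Carrier)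

infixr 2 _×ᵍ_

_×ᵍ_ : Graded → Graded → Graded
X ×ᵍ Y = record
  { Carrier = X.Carrier × Y.Carrier
  ; _⟶_     = λ (x , y) (x′ , y′) → (x X.⟶ x′ × y ≡ y′) ⊎ (x ≡ x′ × y Y.⟶ y′)
  ; rank    = λ (x , y) → X.rank x + Y.rank y
  ; rank-⟶  = λ where
      (inj₁ (s , refl)) → cong (_+ _) (X.rank-⟶ s)
      (inj₂ (refl , s)) → trans (cong (_ +_) (Y.rank-⟶ s)) (ℕ.+-suc _ _)
  }
  where
  module X = Graded X
  module Y = Graded Y

module _ (X : Graded) where
  open Graded X

  IsPath : (ℕ → Carrier X) → ℕ → Set
  IsPath f ℓ = ∀ {i} → i < ℓ → f i ⟶ f (suc i)

  -- The chain is vertex 0 ⟶ … ⟶ vertex len; later values of vertex are junk.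
  record SymmetricChain (h : ℕ) : Set where
    field
      vertex    : ℕ → Carrier X
      len       : ℕ
      isPath    : IsPath vertex len
      symmetric : rank (vertex 0) + rank (vertex len) ≡ h

    vertices : List (Carrier X)
    vertices = applyUpTo vertex (suc len)

  open SymmetricChain

  -- Decomposing a list instead of a whole graded set allows pieces such as triangles to be treated
  -- alone. Since `_↭_` counts multiplicities, this is a partition once the list has no duplicates.
  Decomposition : ℕ → List (Carrier X) → Set
  Decomposition h xs = ∃ λ (cs : List (SymmetricChain h)) → concatMap vertices cs ↭ xs

open SymmetricChain

module _ {X : Graded} where

  resp-↭ : ∀ {xs ys} → xs ↭ ys → Decomposition X h xs → Decomposition X h ys
  resp-↭ xs↭ys (cs , cs↭xs) = cs , ↭-trans cs↭xs xs↭ys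

  infixr 5 _∷ᵈ_ _++ᵈ_

  _∷ᵈ_ : ∀ {xs} (c : SymmetricChain X h) → Decomposition X h xs → Decomposition X h (vertices c ++ xs)
  c ∷ᵈ (cs , cs↭xs) = c ∷ cs , ↭.++⁺ˡ (vertices c) cs↭xs

  _++ᵈ_ : ∀ {xs ys} → Decomposition X h xs → Decomposition X h ys → Decomposition X h (xs ++ ys)
  (cs , cs↭xs) ++ᵈ (ds , ds↭ys) =
    cs ++ ds , ↭-trans (↭-reflexive (concatMap-++ vertices cs ds)) (↭.++⁺ cs↭xs ds↭ys)

module _ {X Y : Graded} (φ : Carrier X → Carrier Y) where
  private
    module X = Graded X
    module Y = Graded Y

  module _ (φ-⟶ : ∀ {x y} → x X.⟶ y → φ x Y.⟶ φ y)
           (φ-rank : ∀ x → Y.rank (φ x) ≡ X.rank x) where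

    mapChain : SymmetricChain X h → SymmetricChain Y h
    mapChain c = record
      { vertex    = φ ∘ vertex c
      ; len       = len c
      ; isPath    = φ-⟶ ∘ isPath c
      ; symmetric = trans (cong₂ _+_ (φ-rank _) (φ-rank _)) (symmetric c)
      }

    mapDecomposition : ∀ {xs} → Decomposition X h xs → Decomposition Y h (map φ xs)
    mapDecomposition (cs , cs↭xs) =
      map mapChain cs , ↭-trans (↭-reflexive (vertices-map cs)) (↭.map⁺ φ cs↭xs)
      where
      vertices-map : (cs : List (SymmetricChain X h)) →
        concatMap vertices (map mapChain cs) ≡ map φ (concatMap vertices cs)
      vertices-map []       = refl
      vertices-map (c ∷ cs) = trans
        (cong₂ _++_ (sym (map-applyUpTo (vertex c) φ (suc (len c)))) (vertices-map cs))
        (sym (map-++ φ (vertices c) _))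

-- g 0, …, g (b − 1), f 0, f 1, …
splice : (ℕ → A) → ℕ → (ℕ → A) → ℕ → A
splice g zero    f i       = f i
splice g (suc b) f zero    = g zero
splice g (suc b) f (suc i) = splice (g ∘ suc) b f i

applyUpTo-splice : ∀ (g : ℕ → A) b f a →
  applyUpTo (splice g b f) (b + a) ≡ applyUpTo g b ++ applyUpTo f a
applyUpTo-splice g zero    f a = refl
applyUpTo-splice g (suc b) f a = cong (g 0 ∷_) (applyUpTo-splice (g ∘ suc) b f a)

splice-+ : ∀ (g : ℕ → A) b f a → splice g b f (b + a) ≡ f a
splice-+ g zero    f a = refl
splice-+ g (suc b) f a = splice-+ (g ∘ suc) b f a

-- For `b = 0` the first value already comes from `f`, so the two paths have to agree at the
-- junction.
splice-0 : ∀ (g : ℕ → A) b f → g b ≡ f 0 → splice g b f 0 ≡ g 0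
splice-0 g zero    f eq = sym eq
splice-0 g (suc b) f eq = refl

splice-path : ∀ X {g b f a} → IsPath X g b → IsPath X f a → g b ≡ f 0 → IsPath X (splice g b f) (b + a)
splice-path X {b = zero}          g-path f-path eq i<         = f-path i<
splice-path X {g} {suc b} {f} g-path f-path eq {zero}  _        =
  subst (Graded._⟶_ X (g 0)) (sym (splice-0 (g ∘ suc) b f eq)) (g-path z<s)
splice-path X {b = suc b} g-path f-path eq {suc i} (s<s i<) =
  splice-path X {b = b} (g-path ∘ s<s) f-path eq i<

-- Hooks, grids and products

module _ {X Y : Graded} where
  private
    module X = Graded X
    module Y = Graded Y

  module _ (f : ℕ → X.Carrier) (a : ℕ) (g : ℕ → Y.Carrier) (b : ℕ)
           (f-path : IsPath X f a) (g-path : IsPath Y g b)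
           (ends : (X.rank (f 0) + X.rank (f a)) + (Y.rank (g 0) + Y.rank (g b)) ≡ h) where

    -- Its ends are the lowest and the highest corner of the grid, so its rank sum is the one given
    -- by `ends`.
    hook : SymmetricChain (X ×ᵍ Y) h
    hook = record
      { vertex    = splice (λ i → f 0 , g i) b (λ i → f i , g b)
      ; len       = b + a
      ; isPath    = splice-path (X ×ᵍ Y) {b = b} (λ i<b → inj₂ (refl , g-path i<b)) (λ i<a → inj₁ (f-path i<a , refl)) refl
      ; symmetric = trans
          (cong₂ _+_ (cong (Graded.rank (X ×ᵍ Y)) (splice-0 (λ i → f 0 , g i) b (λ i → f i , g b) refl))
                     (cong (Graded.rank (X ×ᵍ Y)) (splice-+ (λ i → f 0 , g i) b (λ i → f i , g b) a)))
          (trans (interchange ℕ.+-commutativeSemigroup (X.rank (f 0)) (Y.rank (g 0)) (X.rank (f a)) (Y.rank (g b))) ends)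
      }

    hook-vertices : vertices hook ≡ map (f 0 ,_) (applyUpTo g b) ++ map (_, g b) (applyUpTo f (suc a))
    hook-vertices = begin
      applyUpTo (splice (λ i → f 0 , g i) b (λ i → f i , g b)) (suc (b + a))
        ≡⟨ cong (applyUpTo (splice (λ i → f 0 , g i) b (λ i → f i , g b))) (ℕ.+-suc b a) ⟨
      applyUpTo (splice (λ i → f 0 , g i) b (λ i → f i , g b)) (b + suc a)
        ≡⟨ applyUpTo-splice (λ i → f 0 , g i) b (λ i → f i , g b) (suc a) ⟩
      applyUpTo (λ i → f 0 , g i) b ++ applyUpTo (λ i → f i , g b) (suc a)
        ≡⟨ cong₂ _++_ (map-applyUpTo g (f 0 ,_) b) (map-applyUpTo f (_, g b) (suc a)) ⟨
      map (f 0 ,_) (applyUpTo g b) ++ map (_, g b) (applyUpTo f (suc a))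
        ∎
      where open ≡-Reasoning

  -- Splitting off the last value of `g` yields the upper edge; the row of `f 0` then comes off the
  -- front of the product by unfolding.
  grid-↭-hook : ∀ (f : ℕ → X.Carrier) a (g : ℕ → Y.Carrier) b →
    cartesianProduct (applyUpTo f (suc a)) (applyUpTo g (suc b)) ↭
    (map (f 0 ,_) (applyUpTo g b) ++ map (_, g b) (applyUpTo f (suc a))) ++
    cartesianProduct (applyUpTo (f ∘ suc) a) (applyUpTo g b)
  grid-↭-hook f a g b = begin
    cartesianProduct xs (applyUpTo g (suc b))
      ≡⟨ cong (cartesianProduct xs) (applyUpTo-∷ʳ g b) ⟨
    cartesianProduct xs (applyUpTo g b ++ List.[ g b ])
      ↭⟨ cartesianProduct-++ʳ xs (applyUpTo g b) _ ⟩
    cartesianProduct xs (applyUpTo g b) ++ cartesianProduct xs List.[ g b ]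
      ≡⟨ cong (cartesianProduct xs (applyUpTo g b) ++_) (cartesianProduct-[-]ʳ xs (g b)) ⟩
    (map (f 0 ,_) (applyUpTo g b) ++ rest) ++ map (_, g b) xs
      ↭⟨ ↭.++-assoc (map (f 0 ,_) (applyUpTo g b)) _ _ ⟩
    map (f 0 ,_) (applyUpTo g b) ++ (rest ++ map (_, g b) xs)
      ↭⟨ ↭.++⁺ˡ (map (f 0 ,_) (applyUpTo g b)) (↭.++-comm rest _) ⟩
    map (f 0 ,_) (applyUpTo g b) ++ (map (_, g b) xs ++ rest)
      ↭⟨ ↭.++-assoc (map (f 0 ,_) (applyUpTo g b)) _ _ ⟨
    (map (f 0 ,_) (applyUpTo g b) ++ map (_, g b) xs) ++ rest
      ∎
    where
    open PermutationReasoning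
    xs = applyUpTo f (suc a)
    rest = cartesianProduct (applyUpTo (f ∘ suc) a) (applyUpTo g b)

  private
    -- The bottom of `f` rises by one rank while the top of `g` drops by one, so the four extreme
    -- ranks keep their sum.
    shrink : ∀ {p p′ q s t t′} → p′ ≡ suc p → t′ ≡ suc t → (p + q) + (s + t′) ≡ h → (p′ + q) + (s + t) ≡ h
    shrink {p = p} {q = q} {s} {t} refl refl eq =
      trans (sym (trans (cong ((p + q) +_) (ℕ.+-suc s t)) (ℕ.+-suc (p + q) (s + t)))) eq

  -- The hook runs along the left and the upper edge of the grid; what remains
  -- is a grid with the same sum of extreme ranks.
  gridDecomposition : ∀ (f : ℕ → X.Carrier) a (g : ℕ → Y.Carrier) b →
    IsPath X f a → IsPath Y g b →
    (X.rank (f 0) + X.rank (f a)) + (Y.rank (g 0) + Y.rank (g b)) ≡ h →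
    Decomposition (X ×ᵍ Y) h (cartesianProduct (applyUpTo f (suc a)) (applyUpTo g (suc b)))
  gridDecomposition f a g b f-path g-path ends = resp-↭
    (↭-trans (↭-reflexive (cong (_++ cartesianProduct (applyUpTo (f ∘ suc) a) (applyUpTo g b))
                                (hook-vertices f a g b f-path g-path ends)))
             (↭-sym (grid-↭-hook f a g b)))
    (hook f a g b f-path g-path ends ∷ᵈ inner a b f-path g-path ends)
    where
    inner : ∀ a b → IsPath X f a → IsPath Y g b →
      (X.rank (f 0) + X.rank (f a)) + (Y.rank (g 0) + Y.rank (g b)) ≡ h →
      Decomposition (X ×ᵍ Y) h (cartesianProduct (applyUpTo (f ∘ suc) a) (applyUpTo g b))
    -- A grid that is one point wide in either direction is exhausted by its hook.
    inner zero    b       _      _      _    = [] , ↭-refl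
    inner (suc a) zero    _      _      _    =
      [] , ↭-reflexive (sym (cartesianProductWith-zeroʳ _,_ (applyUpTo (f ∘ suc) (suc a))))
    inner (suc a) (suc b) f-path g-path ends =
      gridDecomposition (f ∘ suc) a g b (f-path ∘ s<s) (g-path ∘ ℕ.m<n⇒m<1+n)
        (shrink {q = X.rank (f (suc a))} {Y.rank (g 0)} (X.rank-⟶ (f-path z<s)) (Y.rank-⟶ (g-path (ℕ.n<1+n b))) ends)

  chain×Decomposition : ∀ (c : SymmetricChain X h) (ds : List (SymmetricChain Y h′)) →
    Decomposition (X ×ᵍ Y) (h + h′) (cartesianProduct (vertices c) (concatMap vertices ds))
  chain×Decomposition c []       =
    [] , ↭-reflexive (sym (cartesianProductWith-zeroʳ _,_ (vertices c)))
  chain×Decomposition c (d ∷ ds) = resp-↭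
    (↭-sym (cartesianProduct-++ʳ (vertices c) (vertices d) (concatMap vertices ds)))
    (gridDecomposition (vertex c) (len c) (vertex d) (len d) (isPath c) (isPath d)
       (cong₂ _+_ (symmetric c) (symmetric d))
     ++ᵈ chain×Decomposition c ds)

  -- The classical product theorem for symmetric chain orders: a chain of each factor spans a grid,
  -- and the two rank sums add.
  productDecomposition : ∀ {xs ys} → Decomposition X h xs → Decomposition Y h′ ys →
    Decomposition (X ×ᵍ Y) (h + h′) (cartesianProduct xs ys)
  productDecomposition (cs , cs↭xs) (ds , ds↭ys) =
    resp-↭ (cartesianProduct⁺ cs↭xs ds↭ys) (go cs)
    where
    go : ∀ cs → Decomposition (X ×ᵍ Y) _
                  (cartesianProduct (concatMap vertices cs) (concatMap vertices ds))
    go []       = [] , ↭-refl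
    go (c ∷ cs) = resp-↭
      (↭-reflexive (sym (cartesianProductWith-distribʳ-++ _,_ (vertices c) (concatMap vertices cs) _)))
      (chain×Decomposition c ds ++ᵈ go cs)

-- Triangles and the symmetric square

module _ {X : Graded} where
  open Graded X using (rank; rank-⟶)

  -- The hook collects the pairs that contain an end of the chain: `f 0` gives the left edge,
  -- `f (suc a)` the upper one. The other pairs form the triangle of the chain without its two ends.
  triangle-↭-hook : ∀ (f : ℕ → Carrier X) a →
    unorderedPairs (applyUpTo f (suc (suc a))) ↭
    (map (f 0 ,_) (applyUpTo f (suc a)) ++ map (_, f (suc a)) (applyUpTo f (suc (suc a)))) ++
    unorderedPairs (applyUpTo (f ∘ suc) a)
  triangle-↭-hook f a = begin
    unorderedPairs (applyUpTo f (suc (suc a)))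
      ≡⟨ cong unorderedPairs (applyUpTo-∷ʳ f (suc a)) ⟨
    unorderedPairs (xs ++ List.[ z ])
      ↭⟨ unorderedPairs-++ xs _ ⟩
    (left ++ rest) ++ (cartesianProduct xs List.[ z ] ++ List.[ z , z ])
      ≡⟨ cong (λ zs → (left ++ rest) ++ (zs ++ List.[ z , z ])) (cartesianProduct-[-]ʳ xs z) ⟩
    (left ++ rest) ++ (map (_, z) xs ++ List.[ z , z ])
      ≡⟨ cong ((left ++ rest) ++_) (map-++ (_, z) xs _) ⟨
    (left ++ rest) ++ map (_, z) (xs ++ List.[ z ])
      ≡⟨ cong (λ zs → (left ++ rest) ++ map (_, z) zs) (applyUpTo-∷ʳ f (suc a)) ⟩
    (left ++ rest) ++ upper
      ↭⟨ ↭.++-assoc left rest upper ⟩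
    left ++ (rest ++ upper)
      ↭⟨ ↭.++⁺ˡ left (↭.++-comm rest upper) ⟩
    left ++ (upper ++ rest)
      ↭⟨ ↭.++-assoc left upper rest ⟨
    (left ++ upper) ++ rest
      ∎
    where
    open PermutationReasoning
    xs = applyUpTo f (suc a)
    z  = f (suc a)
    left = map (f 0 ,_) xs
    upper = map (_, z) (applyUpTo f (suc (suc a)))
    rest = unorderedPairs (applyUpTo (f ∘ suc) a)

  -- Dropping both ends of a chain preserves its rank sum, and the corners of the triangle have
  -- twice that sum.
  triangleDecomposition : ∀ (f : ℕ → Carrier X) a → IsPath X f a →
    (rank (f 0) + rank (f a)) + (rank (f 0) + rank (f a)) ≡ h →
    Decomposition (X ×ᵍ X) h (unorderedPairs (applyUpTo f (suc a)))
  -- A single point is a hook whose two edges have length zero.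
  triangleDecomposition f zero    f-path ends =
    hook f 0 f 0 f-path f-path ends ∷ᵈ ([] , ↭-refl)
  triangleDecomposition f (suc a) f-path ends = resp-↭
    (↭-trans (↭-reflexive (cong (_++ unorderedPairs (applyUpTo (f ∘ suc) a))
                                (hook-vertices {X} {X} f (suc a) f (suc a) f-path f-path ends)))
             (↭-sym (triangle-↭-hook f a)))
    (hook f (suc a) f (suc a) f-path f-path ends ∷ᵈ inner a f-path ends)
    where
    inner : ∀ a → IsPath X f (suc a) →
      (rank (f 0) + rank (f (suc a))) + (rank (f 0) + rank (f (suc a))) ≡ h →
      Decomposition (X ×ᵍ X) h (unorderedPairs (applyUpTo (f ∘ suc) a))
    -- On a chain of two points the hook already takes all three pairs.
    inner zero    _      _    = [] , ↭-refl
    inner (suc a) f-path ends =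
      triangleDecomposition (f ∘ suc) a (f-path ∘ s<s ∘ ℕ.m<n⇒m<1+n)
        (trans (cong₂ _+_ eq eq) ends)
      where
      eq : rank (f 1) + rank (f (suc a)) ≡ rank (f 0) + rank (f (suc (suc a)))
      eq = trans (cong (_+ rank (f (suc a))) (rank-⟶ (f-path z<s)))
          (trans (sym (ℕ.+-suc (rank (f 0)) _))
                 (cong (rank (f 0) +_) (sym (rank-⟶ (f-path (ℕ.n<1+n (suc a)))))))

  -- Both kinds of pieces have rank sum `h + h`: a grid adds the sums of two chains, a triangle
  -- counts that of one chain twice.
  unorderedPairsDecomposition : ∀ (cs : List (SymmetricChain X h)) →
    Decomposition (X ×ᵍ X) (h + h) (unorderedPairs (concatMap vertices cs))
  unorderedPairsDecomposition []       = [] , ↭-refl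
  unorderedPairsDecomposition (c ∷ cs) = resp-↭
    (↭-sym (unorderedPairs-++ (vertices c) (concatMap vertices cs)))
    (triangleDecomposition (vertex c) (len c) (isPath c) (cong₂ _+_ (symmetric c) (symmetric c))
     ++ᵈ chain×Decomposition c cs
     ++ᵈ unorderedPairsDecomposition cs)

-- Symmetric chains of the Boolean lattice

BoolGraded : Graded
BoolGraded = record
  { Carrier = Bool
  ; _⟶_     = Bool._<_
  ; rank    = λ b → ∣ b ∷ [] ∣
  ; rank-⟶  = λ { f<t → refl }
  }

SubsetGraded : ℕ → Graded
SubsetGraded n = record
  { Carrier = Subset n
  ; _⟶_     = λ A B → A ⊆ B × ∣ B ∣ ≡ suc ∣ A ∣
  ; rank    = ∣_∣
  ; rank-⟶  = proj₂
  }

∷-rank : ∀ b (A : Subset n) → ∣ b ∷ A ∣ ≡ ∣ b ∷ [] ∣ + ∣ A ∣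
∷-rank false A = refl
∷-rank true  A = refl

∷-⟶ : ∀ {a b} {A B : Subset n} → Graded._⟶_ (BoolGraded ×ᵍ SubsetGraded n) (a , A) (b , B) →
  Graded._⟶_ (SubsetGraded (suc n)) (a ∷ A) (b ∷ B)
∷-⟶ (inj₁ (f<t , refl))                  = out⊆ ⊆-refl , refl
∷-⟶ {a = false} (inj₂ (refl , A⊆B , eq)) = s⊆s A⊆B , eq
∷-⟶ {a = true}  (inj₂ (refl , A⊆B , eq)) = s⊆s A⊆B , cong suc eq

bits : List Bool
bits = false ∷ true ∷ []

-- Written as the image of a product list so that the induction can apply `productDecomposition`
-- directly.
subsets : ∀ n → List (Subset n)
subsets zero    = List.[ [] ]
subsets (suc n) = map (λ (b , A) → b ∷ A) (cartesianProduct bits (subsets n))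

∈-subsets : (A : Subset n) → A Propositional.∈ subsets n
∈-subsets []      = here refl
∈-subsets (b ∷ A) =
  Propositional.∈-map⁺ _ (Propositional.∈-cartesianProduct⁺ {xs = bits} (∈-bits b) (∈-subsets A))
  where
  ∈-bits : ∀ b → b Propositional.∈ bits
  ∈-bits false = here refl
  ∈-bits true  = there (here refl)

subsets-unique : ∀ n → Propositional.Unique (subsets n)
subsets-unique zero    = [] ∷ []
subsets-unique (suc n) = Propositional.map⁺
  (λ eq → let (b≡ , A≡) = ∷-injective eq in cong₂ _,_ b≡ A≡)
  (Propositional.cartesianProduct⁺ (((λ ()) ∷ []) ∷ [] ∷ []) (subsets-unique n))

subsetsDecomposition : ∀ n → Decomposition (SubsetGraded n) n (subsets n)
subsetsDecomposition zero    =
  record { vertex = λ _ → [] ; len = 0 ; isPath = λ () ; symmetric = refl } ∷ [] , _↭_.refl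
subsetsDecomposition (suc n) = mapDecomposition _ ∷-⟶ (λ (b , A) → ∷-rank b A)
  (productDecomposition {xs = bits} (bitChain ∷ [] , _↭_.refl) (subsetsDecomposition n))
  where
  bitChain : SymmetricChain BoolGraded 1
  bitChain = record
    { vertex    = λ { zero → false ; (suc _) → true }
    ; len       = 1
    ; isPath    = λ { z<s → f<t }
    ; symmetric = refl
    }

-- Unique representatives of unordered pairs

module _ {A : Set} where

  _≈ˢ_ : A × A → A × A → Set
  p ≈ˢ q = p ≡ q ⊎ p ≡ swap q

  unordered : Setoid _ _
  unordered = record
    { Carrier       = A × A
    ; _≈_           = _≈ˢ_
    ; isEquivalence = record
      { refl  = inj₁ refl
      ; sym   = λ { (inj₁ refl) → inj₁ refl ; (inj₂ refl) → inj₂ refl }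
      ; trans = λ { (inj₁ refl) q → q ; (inj₂ refl) (inj₁ refl) → inj₂ refl ; (inj₂ refl) (inj₂ refl) → inj₁ refl }
      }
    }

  unorderedPairs-All : ∀ {P : Pred A 0ℓ} {xs} → All P xs → All (λ (x , y) → P x × P y) (unorderedPairs xs)
  unorderedPairs-All []         = []
  unorderedPairs-All (px ∷ pxs) =
    All.++⁺ (All.map⁺ (All.map (px ,_) (px ∷ pxs))) (unorderedPairs-All pxs)

  -- Every pair in the first row contains `x`, and no pair in a later row does.
  unorderedPairs-unique : ∀ {xs} → Propositional.Unique xs → Unique.Unique unordered (unorderedPairs xs)
  unorderedPairs-unique []         = []
  unorderedPairs-unique {x ∷ xs} (x∉ ∷ xs!) = AllPairs.++⁺
    (AllPairs.map⁺ (AllPairs.map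
      -- If `(x , y)` is `(x , z)` reversed, then both `y` and `z` are `x`, so they agree in this
      -- case too.
      (λ y≢z → λ { (inj₁ refl) → y≢z refl ; (inj₂ refl) → y≢z refl }) (x∉ ∷ xs!)))
    (unorderedPairs-unique xs!)
    (All.map⁺ (All.universal
      (λ y → All.map (λ (x≢u , x≢v) → λ { (inj₁ refl) → x≢u refl ; (inj₂ refl) → x≢v refl })
                     (unorderedPairs-All x∉))
      (x ∷ xs)))

  -- Whichever of `x` and `y` is found first in `xs` leads the listed pair; `inj₂` records a
  -- reversal.
  ∈-unorderedPairs : ∀ {xs x y} → x Propositional.∈ xs → y Propositional.∈ xs →
    Membership._∈_ unordered (x , y) (unorderedPairs xs)
  ∈-unorderedPairs (here refl) y∈ =
    Any.++⁺ˡ (Any.map⁺ (Any.map (λ { refl → inj₁ refl }) y∈))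
  ∈-unorderedPairs (there x∈) (here refl) =
    Any.++⁺ˡ (Any.map⁺ (Any.map (λ { refl → inj₂ refl }) (there x∈)))
  ∈-unorderedPairs {x ∷ xs} (there x∈) (there y∈) =
    Any.++⁺ʳ (map (x ,_) (x ∷ xs)) (∈-unorderedPairs x∈ y∈)

-- Partitions from duplicate-free concatenations

module _ {c ℓ} (S : Setoid c ℓ) where
  open Membership S using () renaming (_∈_ to _∈ₛ_)
  private
    module S = Setoid S

  ++-disjoint : ∀ xs {ys} → Unique.Unique S (xs ++ ys) → ∀ {x} → x ∈ₛ xs → ¬ x ∈ₛ ys
  ++-disjoint (x ∷ xs) (x∉ ∷ _)  (here y≈x) y∈ys =
    All.All¬⇒¬Any (All.++⁻ʳ xs x∉) (Any.map (S.trans (S.sym y≈x)) y∈ys)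
  ++-disjoint (x ∷ xs) (_ ∷ xs!) (there y∈) y∈ys = ++-disjoint xs xs! y∈ y∈ys

  ++-uniqueʳ : ∀ xs {ys} → Unique.Unique S (xs ++ ys) → Unique.Unique S ys
  ++-uniqueʳ []       ys!       = ys!
  ++-uniqueʳ (_ ∷ xs) (_ ∷ xs!) = ++-uniqueʳ xs xs!

  -- An element lying in two blocks would make two positions of the concatenation equivalent.
  concat-∃! : ∀ (xss : List (List⁺ S.Carrier)) → Unique.Unique S (concatMap toList xss) →
    ∀ {x} → x ∈ₛ concatMap toList xss → ∃! _≡_ λ i → x ∈ₛ toList (lookup xss i)
  concat-∃! (xs ∷ xss) xss! {x} x∈ with Any.++⁻ (toList xs) x∈
  ... | inj₁ x∈xs = zero , x∈xs , λ
    { {zero}  _   → refl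
    ; {suc j} x∈j → contradiction (Any.concat⁺ (Any.map⁺ (lookup⁺ xss j x∈j))) (++-disjoint (toList xs) xss! x∈xs)
    }
    where
    lookup⁺ : ∀ xss j → x ∈ₛ toList (lookup xss j) → Any ((x ∈ₛ_) ∘ toList) xss
    lookup⁺ (_ ∷ _)   zero    x∈ = here x∈
    lookup⁺ (_ ∷ xss) (suc j) x∈ = there (lookup⁺ xss j x∈)
  ... | inj₂ x∈xss =
    let (i , x∈i , i!) = concat-∃! xss (++-uniqueʳ (toList xs) xss!) x∈xss in
    suc i , x∈i , λ
    { {zero}  x∈xs → contradiction x∈xss (++-disjoint (toList xs) xss! x∈xs)
    ; {suc j} x∈j  → cong suc (i! x∈j)
    }

-- Rank and covering relation of the quotient

last-∷ : ∀ {A : Set} (x y : A) ys → last (x ∷ y ∷ ys) ≡ last (y ∷ ys)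
last-∷ x y ys with List.initLast ys
... | List.[]       = refl
... | _ List.∷ʳ′ _  = refl

-- Its `toList` is definitionally `applyUpTo f (suc ℓ)`, the form of `vertices`.
applyUpTo⁺ : {A : Set} → (ℕ → A) → ℕ → List⁺ A
applyUpTo⁺ f ℓ = f 0 ∷ applyUpTo (f ∘ suc) ℓ

last-applyUpTo⁺ : ∀ {A : Set} (f : ℕ → A) ℓ → last (applyUpTo⁺ f ℓ) ≡ f ℓ
last-applyUpTo⁺ f zero    = refl
last-applyUpTo⁺ f (suc ℓ) = trans (last-∷ (f 0) (f 1) (applyUpTo (λ i → f (suc (suc i))) ℓ)) (last-applyUpTo⁺ (f ∘ suc) ℓ)

-- `C` is `A` together with the first element of `B` that it misses. This will exclude covers that
-- skip a rank.
⊆-interpolate : ∀ {A B : Subset n} → A ⊆ B → ∣ A ∣ < ∣ B ∣ → ∃[ C ] A ⊆ C × C ⊆ B × ∣ C ∣ ≡ suc ∣ A ∣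
⊆-interpolate {A = []}        {[]}        _   ()
⊆-interpolate {A = false ∷ A} {true ∷ B}  A⊆B _ = true ∷ A , out⊆ ⊆-refl , s⊆s (drop-∷-⊆ A⊆B) , refl
⊆-interpolate {A = true ∷ A}  {false ∷ B} A⊆B _ = case A⊆B here of λ ()
⊆-interpolate {A = false ∷ A} {false ∷ B} A⊆B lt =
  let (C , A⊆C , C⊆B , eq) = ⊆-interpolate (drop-∷-⊆ A⊆B) lt in
  false ∷ C , s⊆s A⊆C , s⊆s C⊆B , eq
⊆-interpolate {A = true ∷ A}  {true ∷ B}  A⊆B lt =
  let (C , A⊆C , C⊆B , eq) = ⊆-interpolate (drop-∷-⊆ A⊆B) (s<s⁻¹ lt) in
  true ∷ C , s⊆s A⊆C , s⊆s C⊆B , cong suc eq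

⊆∧∣∣≡⇒≡ : ∀ {A B : Subset n} → A ⊆ B → ∣ A ∣ ≡ ∣ B ∣ → A ≡ B
⊆∧∣∣≡⇒≡ {A = []}        {[]}        _   _ = refl
⊆∧∣∣≡⇒≡ {A = false ∷ A} {false ∷ B} A⊆B eq = cong (false ∷_) (⊆∧∣∣≡⇒≡ (drop-∷-⊆ A⊆B) eq)
⊆∧∣∣≡⇒≡ {A = true ∷ A}  {true ∷ B}  A⊆B eq = cong (true ∷_) (⊆∧∣∣≡⇒≡ (drop-∷-⊆ A⊆B) (ℕ.suc-injective eq))
⊆∧∣∣≡⇒≡ {A = true ∷ A}  {false ∷ B} A⊆B _ = case A⊆B here of λ ()
⊆∧∣∣≡⇒≡ {A = false ∷ A} {true ∷ B}  A⊆B eq =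
  contradiction (p⊆q⇒∣p∣≤∣q∣ (drop-∷-⊆ A⊆B)) (ℕ.<⇒≱ (ℕ.≤-reflexive (sym eq)))

-- ascent A 0, …, ascent A ∣ A ∣ is a saturated chain from ⊥ to A.
ascent : Subset n → ℕ → Subset n
ascent []          i       = []
ascent (false ∷ A) i       = false ∷ ascent A i
ascent (true ∷ A)  zero    = ⊥
ascent (true ∷ A)  (suc i) = true ∷ ascent A i

ascent-0 : ∀ (A : Subset n) → ascent A 0 ≡ ⊥
ascent-0 []          = refl
ascent-0 (false ∷ A) = cong (false ∷_) (ascent-0 A)
ascent-0 (true ∷ A)  = refl

ascent-∣∣ : ∀ (A : Subset n) → ascent A ∣ A ∣ ≡ A
ascent-∣∣ []          = refl
ascent-∣∣ (false ∷ A) = cong (false ∷_) (ascent-∣∣ A)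
ascent-∣∣ (true ∷ A)  = cong (true ∷_) (ascent-∣∣ A)

ascent-path : ∀ (A : Subset n) → IsPath (SubsetGraded n) (ascent A) ∣ A ∣
ascent-path []          ()
ascent-path (false ∷ A) i<           = ∷-⟶ (inj₂ (refl , ascent-path A i<))
-- The next vertex is `true ∷ ascent A 0`, that is, `⊥` with its first bit set.
ascent-path (true ∷ A)  {zero}  _    rewrite ascent-0 A = out⊆ ⊆-refl , refl
ascent-path (true ∷ A)  {suc i} i<   = ∷-⟶ (inj₂ (refl , ascent-path A (s<s⁻¹ i<)))

module _ (G : Subgroup n) where
  open Poset (BooleanQuotient G) using (module Eq)
    renaming (_≈_ to _~_)
  open PosetProperties (BooleanQuotient G) using () renaming (_<_ to _<ᴳ_)

  private
    infix 4 _⋖ᴳ_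
    _⋖ᴳ_ = _⋖_ (BooleanQuotient G)

  ~⇒∣∣≡ : ∀ {A B} → A ~ B → ∣ A ∣ ≡ ∣ B ∣
  ~⇒∣∣≡ {B = B} (mkOrbit σ _ refl) = ∣image∣ σ B

  ⊆⇒≤ᴳ : ∀ {A B : Subset n} → A ⊆ B → _≤ᴳ_ G A B
  ⊆⇒≤ᴳ = mk≤ Eq.refl Eq.refl

  -- Nested representatives of equal size coincide, which would make the orbits equal.
  <ᴳ⇒∣∣< : ∀ {A B} → A <ᴳ B → ∣ A ∣ < ∣ B ∣
  <ᴳ⇒∣∣< {A} {B} (mk≤ X~A Y~B X⊆Y , A≁B) = ℕ.≤∧≢⇒< ∣A∣≤∣B∣ λ ∣A∣≡∣B∣ →
    case ⊆∧∣∣≡⇒≡ X⊆Y (trans (~⇒∣∣≡ X~A) (trans ∣A∣≡∣B∣ (sym (~⇒∣∣≡ Y~B)))) of λ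
    { refl → A≁B (Eq.trans (Eq.sym X~A) Y~B) }
    where
    ∣A∣≤∣B∣ : ∣ A ∣ ≤ ∣ B ∣
    ∣A∣≤∣B∣ = begin
      ∣ A ∣ ≡⟨ ~⇒∣∣≡ X~A ⟨
      _     ≤⟨ p⊆q⇒∣p∣≤∣q∣ X⊆Y ⟩
      _     ≡⟨ ~⇒∣∣≡ Y~B ⟩
      ∣ B ∣ ∎
      where open ℕ.≤-Reasoning

  -- An orbit strictly in between would have a size strictly between two consecutive numbers.
  ⟶⇒⋖ : ∀ {A B} → Graded._⟶_ (SubsetGraded n) A B → A ⋖ᴳ B
  ⟶⇒⋖ {A} {B} (A⊆B , ∣B∣≡) =
    (⊆⇒≤ᴳ A⊆B , λ A~B → ℕ.1+n≢n (trans (sym ∣B∣≡) (sym (~⇒∣∣≡ A~B)))) ,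
    λ C (A<C , C<B) → ℕ.<⇒≱ (<ᴳ⇒∣∣< C<B) (subst (_≤ ∣ C ∣) (sym ∣B∣≡) (<ᴳ⇒∣∣< A<C))

  -- With a larger gap, a set interpolated between the nested representatives `X` and `Y` would lie
  -- strictly between the orbits; its size tells it apart from both.
  ⋖⇒∣∣≡ : ∀ {A B} → A ⋖ᴳ B → ∣ B ∣ ≡ suc ∣ A ∣
  ⋖⇒∣∣≡ {A} {B} (A<B@(mk≤ {X} {Y} X~A Y~B X⊆Y , A≁B) , none) with ∣ B ∣ ℕ.≟ suc ∣ A ∣
  ... | yes eq = eq
  ... | no  ∣B∣≢ = contradiction ((A≤C , A≁C) , (C≤B , C≁B)) (none C)
    where
    ∣A∣<∣B∣ = <ᴳ⇒∣∣< A<B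
    interpolant = ⊆-interpolate X⊆Y
      (subst (_< ∣ Y ∣) (sym (~⇒∣∣≡ X~A)) (subst (∣ A ∣ <_) (sym (~⇒∣∣≡ Y~B)) ∣A∣<∣B∣))
    C = proj₁ interpolant
    ∣C∣≡ : ∣ C ∣ ≡ suc ∣ A ∣
    ∣C∣≡ = trans (proj₂ (proj₂ (proj₂ interpolant))) (cong suc (~⇒∣∣≡ X~A))
    A≤C : _≤ᴳ_ G A C
    A≤C = mk≤ X~A Eq.refl (proj₁ (proj₂ interpolant))
    C≤B : _≤ᴳ_ G C B
    C≤B = mk≤ Eq.refl Y~B (proj₁ (proj₂ (proj₂ interpolant)))
    A≁C : ¬ A ~ C
    A≁C A~C = ℕ.1+n≢n (trans (sym ∣C∣≡) (sym (~⇒∣∣≡ A~C)))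
    C≁B : ¬ C ~ B
    C≁B C~B = ∣B∣≢ (trans (sym (~⇒∣∣≡ C~B)) ∣C∣≡)

  path⇒saturated : ∀ {f ℓ} → IsPath (SubsetGraded n) f ℓ → IsSaturated (BooleanQuotient G) (applyUpTo⁺ f ℓ)
  path⇒saturated {f} {ℓ} path = Linked.applyUpTo⁺₁ f (suc ℓ) (⟶⇒⋖ ∘ path ∘ s<s⁻¹)

  saturated⇒∣∣ : ∀ A As → IsSaturated (BooleanQuotient G) (A ∷ As) → ∣ last (A ∷ As) ∣ ≡ ∣ A ∣ + length As
  saturated⇒∣∣ A []       _           = sym (ℕ.+-identityʳ ∣ A ∣)
  saturated⇒∣∣ A (B ∷ As) (A⋖B ∷ sat) = begin
    ∣ last (A ∷ B ∷ As) ∣     ≡⟨ cong ∣_∣ (last-∷ A B As) ⟩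
    ∣ last (B ∷ As) ∣         ≡⟨ saturated⇒∣∣ B As sat ⟩
    ∣ B ∣ + length As         ≡⟨ cong (_+ length As) (⋖⇒∣∣≡ A⋖B) ⟩
    suc (∣ A ∣ + length As)   ≡⟨ ℕ.+-suc ∣ A ∣ (length As) ⟨
    ∣ A ∣ + length (B ∷ As)   ∎
    where open ≡-Reasoning

  -- Cardinality can serve as the rank because it is constant on orbits, vanishes on `⊥` and grows
  -- by one along every cover.
  ranked : Ranked (BooleanQuotient G)
  ranked = record
    { finite          = subsets n , λ A → Any.map (λ { refl → Eq.refl }) (∈-subsets A)
    ; bottom          = ⊥
    ; minimum         = λ A → ⊆⇒≤ᴳ ⊥⊆
    ; rank            = ∣_∣
    ; rank-attained   = λ A →
        applyUpTo⁺ (ascent A) ∣ A ∣ ,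
        (path⇒saturated (ascent-path A) ,
         Eq.reflexive (ascent-0 A) ,
         Eq.reflexive (trans (last-applyUpTo⁺ (ascent A) ∣ A ∣) (ascent-∣∣ A))) ,
        length-applyUpTo (ascent A ∘ suc) ∣ A ∣
    ; rank-unique     = λ { A (B ∷ Bs) (sat , B~⊥ , last~A) →
        trans (cong (_+ length Bs) (sym (trans (~⇒∣∣≡ B~⊥) (∣⊥∣≡0 n))))
              (trans (sym (saturated⇒∣∣ B Bs sat)) (~⇒∣∣≡ last~A)) }
    ; height          = n
    ; rank≤height     = ∣p∣≤n
    ; height-attained = ⊤ , ∣⊤∣≡n n
    }

  -- The conditions on `As` make it a transversal of the orbits, which yields the partition;
  -- saturation and rank sums are inherited from `B_n`.
  decomposition⇒SCO : ∀ {As} → Decomposition (SubsetGraded n) n As →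
    Unique.Unique Eq.setoid As → (∀ A → Membership._∈_ Eq.setoid A As) →
    IsSymmetricChainOrder (BooleanQuotient G)
  decomposition⇒SCO {As} (cs , cs↭As) As! A∈As =
    ranked , map vertices⁺ cs , All.map⁺ (All.universal isSymmetric cs) , partition
    where
    vertices⁺ : SymmetricChain (SubsetGraded n) n → List⁺ (Subset n)
    vertices⁺ c = applyUpTo⁺ (vertex c) (len c)

    isSymmetric : ∀ c → IsSymmetric (BooleanQuotient G) ranked (vertices⁺ c)
    isSymmetric c = path⇒saturated (isPath c) ,
      trans (cong (λ A → ∣ vertex c 0 ∣ + ∣ A ∣) (last-applyUpTo⁺ (vertex c) (len c))) (symmetric c)

    concat-vertices⁺ : ∀ cs → concatMap toList (map vertices⁺ cs) ≡ concatMap vertices cs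
    concat-vertices⁺ []       = refl
    concat-vertices⁺ (c ∷ cs) = cong (vertices c ++_) (concat-vertices⁺ cs)

    As↭ : As ↭ concatMap toList (map vertices⁺ cs)
    As↭ = subst (As ↭_) (sym (concat-vertices⁺ cs)) (↭-sym cs↭As)

    partition : IsPartition (BooleanQuotient G) (map vertices⁺ cs)
    partition A = concat-∃! Eq.setoid (map vertices⁺ cs)
      (↭ₛ.Unique-resp-↭ Eq.setoid (↭⇒↭ₛ′ Eq.isEquivalence As↭) As!)
      (↭.Any-resp-↭ As↭ (A∈As A))

-- Coordinates adapted to the involution

-- Numbering the elements of `S` in increasing order encodes its subsets as `Subset ∣ S ∣`, so that
-- `subsetsDecomposition` applies to them.
expand : (S : Subset n) → Subset ∣ S ∣ → Subset n
expand []          U       = []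
expand (false ∷ S) U       = false ∷ expand S U
expand (true ∷ S)  (b ∷ U) = b ∷ expand S U

-- The trace of `A` on `S` in this numbering: `expand S (contract S A)` is the intersection of the
-- two.
contract : (S : Subset n) → Subset n → Subset ∣ S ∣
contract []          A       = []
contract (false ∷ S) (_ ∷ A) = contract S A
contract (true ∷ S)  (b ∷ A) = b ∷ contract S A

expand-⊆ : ∀ (S : Subset n) U → expand S U ⊆ S
expand-⊆ (false ∷ S) U       (there i∈) = there (expand-⊆ S U i∈)
expand-⊆ (true ∷ S)  (_ ∷ U) here       = here
expand-⊆ (true ∷ S)  (_ ∷ U) (there i∈) = there (expand-⊆ S U i∈)

expand-mono : ∀ (S : Subset n) {U V} → U ⊆ V → expand S U ⊆ expand S V
expand-mono (false ∷ S)                  U⊆V (there i∈) = there (expand-mono S U⊆V i∈)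
expand-mono (true ∷ S) {_ ∷ _} {_ ∷ _}   U⊆V here       = case U⊆V here of λ { here → here }
expand-mono (true ∷ S) {_ ∷ _} {_ ∷ _}   U⊆V (there i∈) = there (expand-mono S (drop-∷-⊆ U⊆V) i∈)

∣expand∣ : ∀ (S : Subset n) U → ∣ expand S U ∣ ≡ ∣ U ∣
∣expand∣ []          []          = refl
∣expand∣ (false ∷ S) U           = ∣expand∣ S U
∣expand∣ (true ∷ S)  (false ∷ U) = ∣expand∣ S U
∣expand∣ (true ∷ S)  (true ∷ U)  = cong suc (∣expand∣ S U)

contract-expand : ∀ (S : Subset n) U → contract S (expand S U) ≡ U
contract-expand []          []      = refl
contract-expand (false ∷ S) U       = contract-expand S U
contract-expand (true ∷ S)  (b ∷ U) = cong (b ∷_) (contract-expand S U)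

∈-expand-contract⁺ : ∀ (S A : Subset n) {i} → i ∈ S → i ∈ A → i ∈ expand S (contract S A)
∈-expand-contract⁺ (_ ∷ S)     (_ ∷ A) here       here       = here
∈-expand-contract⁺ (false ∷ S) (_ ∷ A) (there i∈) (there i∈A) = there (∈-expand-contract⁺ S A i∈ i∈A)
∈-expand-contract⁺ (true ∷ S)  (_ ∷ A) (there i∈) (there i∈A) = there (∈-expand-contract⁺ S A i∈ i∈A)

∈-expand-contract⁻ : ∀ (S A : Subset n) {i} → i ∈ expand S (contract S A) → i ∈ A
∈-expand-contract⁻ (false ∷ S) (_ ∷ A) (there i∈) = there (∈-expand-contract⁻ S A i∈)
∈-expand-contract⁻ (true ∷ S)  (_ ∷ A) here       = here
∈-expand-contract⁻ (true ∷ S)  (_ ∷ A) (there i∈) = there (∈-expand-contract⁻ S A i∈)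

contract-mono : ∀ (S A B : Subset n) → (∀ {i} → i ∈ S → i ∈ A → i ∈ B) → contract S A ⊆ contract S B
contract-mono (false ∷ S) (_ ∷ A) (_ ∷ B) A⊆B i∈         =
  contract-mono S A B (λ i∈S i∈A → drop-there (A⊆B (there i∈S) (there i∈A))) i∈
contract-mono (true ∷ S)  (_ ∷ A) (_ ∷ B) A⊆B here       = case A⊆B here here of λ { here → here }
contract-mono (true ∷ S)  (_ ∷ A) (_ ∷ B) A⊆B (there i∈) =
  there (contract-mono S A B (λ i∈S i∈A → drop-there (A⊆B (there i∈S) (there i∈A))) i∈)

∣∪∣-disjoint : ∀ (A B : Subset n) → (∀ {i} → i ∈ A → i ∉ B) → ∣ A ∪ B ∣ ≡ ∣ A ∣ + ∣ B ∣
∣∪∣-disjoint []          []          _   = refl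
∣∪∣-disjoint (false ∷ A) (false ∷ B) A#B = ∣∪∣-disjoint A B (λ i∈A i∈B → A#B (there i∈A) (there i∈B))
∣∪∣-disjoint (false ∷ A) (true ∷ B)  A#B =
  trans (cong suc (∣∪∣-disjoint A B (λ i∈A i∈B → A#B (there i∈A) (there i∈B)))) (sym (ℕ.+-suc ∣ A ∣ ∣ B ∣))
∣∪∣-disjoint (true ∷ A)  (false ∷ B) A#B =
  cong suc (∣∪∣-disjoint A B (λ i∈A i∈B → A#B (there i∈A) (there i∈B)))
∣∪∣-disjoint (true ∷ A)  (true ∷ B)  A#B = contradiction here (A#B here)

∪-mono : ∀ {A A′ B B′ : Subset n} → A ⊆ A′ → B ⊆ B′ → A ∪ B ⊆ A′ ∪ B′
∪-mono {A = A} {B = B} A⊆ B⊆ = x∈p∪q⁺ ∘ Sum.map A⊆ B⊆ ∘ x∈p∪q⁻ A B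

module _ {P : Pred (Fin n) 0ℓ} (P? : Decidable P) where

  comprehension : Subset n
  comprehension = tabulate (does ∘ P?)

  ∈-comprehension⁺ : ∀ {i} → P i → i ∈ comprehension
  ∈-comprehension⁺ {i} Pi = lookup⇒[]= i _ (trans (lookup∘tabulate _ i) (dec-true (P? i) Pi))

  ∈-comprehension⁻ : ∀ {i} → i ∈ comprehension → P i
  ∈-comprehension⁻ {i} i∈ with P? i | trans (sym (lookup∘tabulate (does ∘ P?) i)) ([]=⇒lookup i∈)
  ... | yes Pi | _ = Pi

module Coordinates (ρ : Permutation′ n) (involutive : ∀ i → ρ ⟨$⟩ˡ (ρ ⟨$⟩ˡ i) ≡ i) where

  private
    -- The inverse of `ρ`, because `ρ [ A ]` is defined through it; for an involution it is `ρ`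
    -- again.
    τ : Fin n → Fin n
    τ = ρ ⟨$⟩ˡ_

    lower? : Decidable λ i → i Fin.< τ i
    lower? i = i Fin.<? τ i

    fixed? : Decidable λ i → i ≡ τ i
    fixed? i = i Fin.≟ τ i

  lower fixed : Subset n
  lower = comprehension lower?
  fixed = comprehension fixed?

  ∈-lower⁺ : ∀ {i} → i Fin.< τ i → i ∈ lower
  ∈-lower⁺ = ∈-comprehension⁺ lower?

  ∈-lower⁻ : ∀ {i} → i ∈ lower → i Fin.< τ i
  ∈-lower⁻ = ∈-comprehension⁻ lower?

  ∈-fixed⁺ : ∀ {i} → i ≡ τ i → i ∈ fixed
  ∈-fixed⁺ = ∈-comprehension⁺ fixed?

  ∈-fixed⁻ : ∀ {i} → i ∈ fixed → i ≡ τ i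
  ∈-fixed⁻ = ∈-comprehension⁻ fixed?

  Triple : Graded
  Triple = (SubsetGraded ∣ lower ∣ ×ᵍ SubsetGraded ∣ lower ∣) ×ᵍ SubsetGraded ∣ fixed ∣

  swap₁ : Carrier Triple → Carrier Triple
  swap₁ (p , W) = swap p , W

  ∈-image⁻ : ∀ A {i} → i ∈ ρ [ A ] → τ i ∈ A
  ∈-image⁻ A {i} i∈ = lookup⇒[]= _ A (trans (sym (lookup∘tabulate _ i)) ([]=⇒lookup i∈))

  ∈-image⁺ : ∀ A {i} → τ i ∈ A → i ∈ ρ [ A ]
  ∈-image⁺ A {i} i∈ = lookup⇒[]= i _ (trans (lookup∘tabulate _ i) ([]=⇒lookup i∈))

  image-involutive : ∀ A → ρ [ ρ [ A ] ] ≡ A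
  image-involutive A = ⊆-antisym
    (λ i∈ → subst (_∈ A) (involutive _) (∈-image⁻ A (∈-image⁻ (ρ [ A ]) i∈)))
    (λ i∈ → ∈-image⁺ (ρ [ A ]) (∈-image⁺ A (subst (_∈ A) (sym (involutive _)) i∈)))

  lower⇒τ∉lower : ∀ {i} → i ∈ lower → τ i ∉ lower
  lower⇒τ∉lower {i} i∈ τi∈ = Fin.<-asym
    (∈-lower⁻ i∈)
    (subst (τ i Fin.<_) (involutive i) (∈-lower⁻ τi∈))

  fixed⇒∉lower : ∀ {i} → i ∈ fixed → i ∉ lower
  fixed⇒∉lower i∈fixed i∈lower = Fin.<⇒≢ (∈-lower⁻ i∈lower) (∈-fixed⁻ i∈fixed)

  τ∈fixed⇒≡ : ∀ {i} → τ i ∈ fixed → i ≡ τ i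
  τ∈fixed⇒≡ {i} τi∈ = sym (trans (∈-fixed⁻ τi∈) (involutive i))

  embed : Carrier Triple → Subset n
  embed ((U , V) , W) = (expand lower U ∪ ρ [ expand lower V ]) ∪ expand fixed W

  -- The part of `A` above the mirror is read off on `lower` after applying `ρ`.
  decode : Subset n → Carrier Triple
  decode A = (contract lower A , contract lower (ρ [ A ])) , contract fixed A

  data Embedded (U V : Subset ∣ lower ∣) (W : Subset ∣ fixed ∣) (i : Fin n) : Set where
    inLow   : i ∈ expand lower U → Embedded U V W i
    inHigh  : τ i ∈ expand lower V → Embedded U V W i
    inFixed : i ∈ expand fixed W → Embedded U V W i

  ∈-embed⁻ : ∀ {U V W i} → i ∈ embed ((U , V) , W) → Embedded U V W i
  ∈-embed⁻ {U} {V} {W} i∈ =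
    [ [ inLow , inHigh ∘ ∈-image⁻ (expand lower V) ]′ ∘ x∈p∪q⁻ (expand lower U) (ρ [ expand lower V ])
    , inFixed ]′ (x∈p∪q⁻ _ (expand fixed W) i∈)

  ∈-embed⁺ : ∀ {U V W i} → Embedded U V W i → i ∈ embed ((U , V) , W)
  ∈-embed⁺ (inLow i∈)       = x∈p∪q⁺ (inj₁ (x∈p∪q⁺ (inj₁ i∈)))
  ∈-embed⁺ {V = V} (inHigh i∈) = x∈p∪q⁺ (inj₁ (x∈p∪q⁺ (inj₂ (∈-image⁺ (expand lower V) i∈))))
  ∈-embed⁺ (inFixed i∈)     = x∈p∪q⁺ (inj₂ i∈)

  embed-decode : ∀ A → embed (decode A) ≡ A
  embed-decode A = ⊆-antisym (fwd ∘ ∈-embed⁻) (λ {i} → ∈-embed⁺ ∘ bwd i)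
    where
    fwd : ∀ {i} → Embedded _ _ _ i → i ∈ A
    fwd (inLow i∈)   = ∈-expand-contract⁻ lower A i∈
    fwd (inHigh i∈)  = subst (_∈ A) (involutive _) (∈-image⁻ A (∈-expand-contract⁻ lower (ρ [ A ]) i∈))
    fwd (inFixed i∈) = ∈-expand-contract⁻ fixed A i∈

    bwd : ∀ i → i ∈ A → Embedded _ _ _ i
    bwd i i∈ with Fin.<-cmp i (τ i)
    ... | tri< i<τi _ _ = inLow (∈-expand-contract⁺ lower A (∈-lower⁺ i<τi) i∈)
    ... | tri≈ _ i≡τi _ = inFixed (∈-expand-contract⁺ fixed A (∈-fixed⁺ i≡τi) i∈)
    ... | tri> _ _ τi<i = inHigh (∈-expand-contract⁺ lower (ρ [ A ])
      (∈-lower⁺ (subst (τ i Fin.<_) (sym (involutive i)) τi<i))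
      (∈-image⁺ A (subst (_∈ A) (sym (involutive i)) i∈)))

  -- One inclusion for all triples suffices: the one for the swapped triple, mapped by `ρ`, is the
  -- reverse inclusion.
  embed-swap : ∀ t → ρ [ embed t ] ≡ embed (swap₁ t)
  embed-swap t = ⊆-antisym (image⊆ t)
    (subst (_⊆ ρ [ embed t ]) (image-involutive _) (image-mono ρ (image⊆ (swap₁ t))))
    where
    image⊆ : ∀ t → ρ [ embed t ] ⊆ embed (swap₁ t)
    image⊆ t@((U , V) , W) {i} i∈ with ∈-embed⁻ {U} {V} {W} (∈-image⁻ (embed t) i∈)
    ... | inLow τi∈   = ∈-embed⁺ (inHigh τi∈)
    ... | inHigh ττi∈ = ∈-embed⁺ {V} {U} {W} (inLow (subst (_∈ expand lower V) (involutive i) ττi∈))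
    ... | inFixed τi∈ = ∈-embed⁺ {V} {U} {W} (inFixed
      (subst (_∈ expand fixed W) (sym (τ∈fixed⇒≡ (expand-⊆ fixed W τi∈))) τi∈))

  -- The three parts of `embed` lie in disjoint blocks, namely `lower`, its mirror image and
  -- `fixed`, so only the first is seen here.
  contract-lower-embed : ∀ U V W → contract lower (embed ((U , V) , W)) ≡ U
  contract-lower-embed U V W = trans
    (⊆-antisym (contract-mono lower (embed ((U , V) , W)) (expand lower U) (λ i∈ → fwd i∈ ∘ ∈-embed⁻))
               (contract-mono lower (expand lower U) (embed ((U , V) , W)) (λ _ → ∈-embed⁺ ∘ inLow)))
    (contract-expand lower U)
    where
    fwd : ∀ {i} → i ∈ lower → Embedded U V W i → i ∈ expand lower U
    fwd _  (inLow i∈)   = i∈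
    fwd i∈ (inHigh τi∈) = contradiction (expand-⊆ lower V τi∈) (lower⇒τ∉lower i∈)
    fwd i∈ (inFixed i∈fixed) = contradiction i∈ (fixed⇒∉lower (expand-⊆ fixed W i∈fixed))

  contract-fixed-embed : ∀ U V W → contract fixed (embed ((U , V) , W)) ≡ W
  contract-fixed-embed U V W = trans
    (⊆-antisym (contract-mono fixed (embed ((U , V) , W)) (expand fixed W) (λ i∈ → fwd i∈ ∘ ∈-embed⁻))
               (contract-mono fixed (expand fixed W) (embed ((U , V) , W)) (λ _ → ∈-embed⁺ ∘ inFixed)))
    (contract-expand fixed W)
    where
    fwd : ∀ {i} → i ∈ fixed → Embedded U V W i → i ∈ expand fixed W
    fwd i∈ (inLow i∈inLow) = contradiction (expand-⊆ lower U i∈inLow) (fixed⇒∉lower i∈)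
    fwd i∈ (inHigh τi∈)  = contradiction
      (subst (_∈ lower) (sym (∈-fixed⁻ i∈)) (expand-⊆ lower V τi∈)) (fixed⇒∉lower i∈)
    fwd _  (inFixed i∈)  = i∈

  decode-embed : ∀ t → decode (embed t) ≡ t
  decode-embed t@((U , V) , W) = cong₂ _,_
    (cong₂ _,_ (contract-lower-embed U V W)
               -- `V` is recovered as the first component of the swapped triple.
               (trans (cong (contract lower) (embed-swap t)) (contract-lower-embed V U W)))
    (contract-fixed-embed U V W)

  embed-injective : ∀ {s t} → embed s ≡ embed t → s ≡ t
  embed-injective {s} {t} eq = trans (sym (decode-embed s)) (trans (cong decode eq) (decode-embed t))

  embed-rank : ∀ t → ∣ embed t ∣ ≡ Graded.rank Triple t
  embed-rank ((U , V) , W) = trans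
    (∣∪∣-disjoint _ (expand fixed W) disjoint₂)
    (cong₂ _+_
      (trans (∣∪∣-disjoint (expand lower U) _ disjoint₁)
             (cong₂ _+_ (∣expand∣ lower U) (trans (∣image∣ ρ (expand lower V)) (∣expand∣ lower V))))
      (∣expand∣ fixed W))
    where
    disjoint₁ : ∀ {i} → i ∈ expand lower U → i ∉ ρ [ expand lower V ]
    disjoint₁ i∈ i∈ρ = lower⇒τ∉lower (expand-⊆ lower U i∈) (expand-⊆ lower V (∈-image⁻ (expand lower V) i∈ρ))

    disjoint₂ : ∀ {i} → i ∈ expand lower U ∪ ρ [ expand lower V ] → i ∉ expand fixed W
    disjoint₂ i∈ i∈W with expand-⊆ fixed W i∈W | x∈p∪q⁻ (expand lower U) _ i∈
    ... | i∈fixed | inj₁ i∈low = fixed⇒∉lower i∈fixed (expand-⊆ lower U i∈low)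
    ... | i∈fixed | inj₂ i∈ρ   = fixed⇒∉lower i∈fixed
      (subst (_∈ lower) (sym (∈-fixed⁻ i∈fixed)) (expand-⊆ lower V (∈-image⁻ (expand lower V) i∈ρ)))

  embed-⟶ : ∀ {s t} → Graded._⟶_ Triple s t → Graded._⟶_ (SubsetGraded n) (embed s) (embed t)
  embed-⟶ {s} {t} s⟶t = mono s⟶t ,
    trans (embed-rank t) (trans (Graded.rank-⟶ Triple s⟶t) (cong suc (sym (embed-rank s))))
    where
    mono : ∀ {s t} → Graded._⟶_ Triple s t → embed s ⊆ embed t
    mono (inj₁ (inj₁ ((U⊆ , _) , refl) , refl)) = ∪-mono (∪-mono (expand-mono lower U⊆) ⊆-refl) ⊆-refl
    mono (inj₁ (inj₂ (refl , V⊆ , _) , refl))   =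
      ∪-mono (∪-mono ⊆-refl (image-mono ρ (expand-mono lower V⊆))) ⊆-refl
    mono (inj₂ (refl , W⊆ , _))                 = ∪-mono ⊆-refl (expand-mono fixed W⊆)

  -- Obtained by evaluating `embed-rank` at the triple of full sets, which embeds onto `⊤`.
  height : (∣ lower ∣ + ∣ lower ∣) + ∣ fixed ∣ ≡ n
  height = trans
    (sym (trans (embed-rank full) (cong₂ _+_ (cong₂ _+_ (∣⊤∣≡n ∣ lower ∣) (∣⊤∣≡n ∣ lower ∣)) (∣⊤∣≡n ∣ fixed ∣))))
    (trans (cong ∣_∣ (⊆-antisym ⊆⊤ ⊤⊆)) (∣⊤∣≡n n))
    where
    full : Carrier Triple
    full = (⊤ , ⊤) , ⊤
    ⊤⊆ : ⊤ ⊆ embed full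
    -- `⊤` is the image of its own decoding, and enlarging each component enlarges the image.
    ⊤⊆ = subst (_⊆ embed full) (embed-decode ⊤)
      (∪-mono (∪-mono (expand-mono lower ⊆⊤) (image-mono ρ (expand-mono lower ⊆⊤))) (expand-mono fixed ⊆⊤))

  -- Pairs are formed from the concatenated chains and not from `subsets`: orientation follows list
  -- order, and the pieces are grids and triangles because each chain is contiguous there.
  representatives : ∃ λ ts → Decomposition Triple n ts ×
    Unique.Unique (unordered ×ₛ setoid _) ts × (∀ t → Membership._∈_ (unordered ×ₛ setoid _) t ts)
  representatives with subsetsDecomposition ∣ lower ∣
  ... | cs , cs↭ =
    cartesianProduct (unorderedPairs As) Ws ,
    subst (λ h → Decomposition Triple h (cartesianProduct (unorderedPairs As) Ws)) height
      (productDecomposition (unorderedPairsDecomposition cs) (subsetsDecomposition ∣ fixed ∣)) ,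
    Unique.cartesianProduct⁺ unordered (setoid _)
      (unorderedPairs-unique (↭ₛ.Unique-resp-↭ (setoid _) (↭⇒↭ₛ (↭-sym cs↭)) (subsets-unique ∣ lower ∣)))
      (subsets-unique ∣ fixed ∣) ,
    λ { ((U , V) , W) → Any.cartesianProduct⁺
      (∈-unorderedPairs (↭.∈-resp-↭ (↭-sym cs↭) (∈-subsets U)) (↭.∈-resp-↭ (↭-sym cs↭) (∈-subsets V)))
      (∈-subsets W) }
    where
    As = concatMap vertices cs
    Ws = subsets ∣ fixed ∣

-- Orbits of the two-element group

module _ (G : Subgroup n) (ρ : Permutation′ n)
         (member : ∀ σ → Subgroup.Member G σ ⇔ (σ ≈ id ⊎ σ ≈ ρ)) where
  open Subgroup G using (Member; ∘-closed)
  open Poset (BooleanQuotient G) using (module Eq) renaming (_≈_ to _~_)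

  ρ-member : Member ρ
  ρ-member = Equivalence.from (member ρ) (inj₂ λ _ → refl)

  -- The square lies in the group, so it is the identity or `ρ`; in the latter case cancelling one
  -- `ρ` shows that `ρ` fixes every point.
  ρ-square : ∀ i → ρ ⟨$⟩ʳ (ρ ⟨$⟩ʳ i) ≡ i
  ρ-square i with Equivalence.to (member (ρ ∘ₚ ρ)) (∘-closed ρ-member ρ-member)
  ... | inj₁ ρρ≈id = ρρ≈id i
  ... | inj₂ ρρ≈ρ  =
    trans (ρρ≈ρ i) (trans (sym (inverseˡ ρ)) (trans (cong (ρ ⟨$⟩ˡ_) (ρρ≈ρ i)) (inverseˡ ρ)))

  ρ-involutive : ∀ i → ρ ⟨$⟩ˡ (ρ ⟨$⟩ˡ i) ≡ i
  ρ-involutive i = trans (cong (λ j → ρ ⟨$⟩ˡ (ρ ⟨$⟩ˡ j)) (sym (ρ-square i)))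
                         (trans (cong (ρ ⟨$⟩ˡ_) (inverseˡ ρ)) (inverseˡ ρ))

  open Coordinates ρ ρ-involutive

  image-≈ : ∀ {σ τ : Permutation′ n} → σ ≈ τ → ∀ A → σ [ A ] ≡ τ [ A ]
  image-≈ {σ} {τ} σ≈τ A = tabulate-cong λ i → cong (Vec.lookup A)
    (trans (sym (inverseˡ τ)) (cong (τ ⟨$⟩ˡ_) (trans (sym (σ≈τ _)) (inverseʳ σ))))

  ~⇒≡⊎≡ : ∀ {A B} → A ~ B → A ≡ B ⊎ A ≡ ρ [ B ]
  ~⇒≡⊎≡ {B = B} (mkOrbit σ σ∈G refl) with Equivalence.to (member σ) σ∈G
  ... | inj₁ σ≈id = inj₁ (trans (image-≈ {σ} {id} σ≈id B) (image-id B))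
  ... | inj₂ σ≈ρ  = inj₂ (image-≈ {σ} {ρ} σ≈ρ B)

  -- An orbit is `B` together with `ρ [ B ]`, and the latter is the embedding of the swapped triple.
  -- Hence inequivalent triples give distinct orbits.
  embed-~⁻ : ∀ {s t} → embed s ~ embed t → Setoid._≈_ (unordered ×ₛ setoid _) s t
  embed-~⁻ {s} {t} s~t with ~⇒≡⊎≡ s~t
  ... | inj₁ eq = case embed-injective {s} {t} eq of λ { refl → inj₁ refl , refl }
  ... | inj₂ eq = case embed-injective {s} {swap₁ t} (trans eq (embed-swap t)) of λ { refl → inj₂ refl , refl }

  embed-~⁺ : ∀ {s t} → Setoid._≈_ (unordered ×ₛ setoid _) s t → embed s ~ embed t
  embed-~⁺         (inj₁ refl , refl) = Eq.refl
  embed-~⁺ {t = t} (inj₂ refl , refl) = mkOrbit ρ ρ-member (embed-swap t)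

  quotientSCO : IsSymmetricChainOrder (BooleanQuotient G)
  quotientSCO = let (ts , ds , ts! , ∈ts) = representatives in
    decomposition⇒SCO G (mapDecomposition embed embed-⟶ embed-rank ds)
      (Unique.map⁺ (unordered ×ₛ setoid _) Eq.setoid embed-~⁻ ts!)
      -- `A` is `embed (decode A)`, and the listed representative differs from `decode A` at most by
      -- a swap.
      (λ A → Any.map⁺ (Any.map (λ eq → subst (_~ _) (embed-decode A) (embed-~⁺ eq)) (∈ts (decode A))))

theorem2p5 : ∀ (n : ℕ) (G : Subgroup n) (ρ : Permutation′ n) →
    ¬ (ρ ≈ id) →
    (∀ σ → Subgroup.Member G σ ⇔ (σ ≈ id ⊎ σ ≈ ρ)) →
    IsProductOfDisjointTranspositions ρ →
    IsSymmetricChainOrder (BooleanQuotient G)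
theorem2p5 n G ρ _ member _ = quotientSCO G ρ member
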